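{- For all integers $b\ge 1$, \[ F(b)<\tfrac12\, g(b+1)-b. \]
   Context: All games are short normal-play two-player combinatorial games (Left and Right; a player unable to move loses), compared up to equality ($Y=Z$ iff $X+Y$ and $X+Z$ have the same outcome for every game $X$, $+$ being the disjunctive sum). The birthday of a game is the maximum length of a sequence of moves (not necessarily alternating) starting from it; a value is born by day $b$ if it equals some game of birthday at most $b$; $\mathbb{G}_b$ is the set of values born by day $b$ and $g(b)=|\mathbb{G}_b|$. A Digraph placement game is played on a finite digraph with vertices coloured blue/red (not necessarily properly): Left chooses a remaining blue vertex and deletes it with all its out-neighbours, Right does the same with a red vertex; a player unable to move loses. For a game $X$, $f(X)$ is the least $n$ such that some Digraph placement game on $n$ vertices equals $X$, and $F(b)=\max_{X\in\mathbb{G}_b}f(X)$. -}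

module Defs where

open import Data.Nat using (ℕ; zero; suc; _+_; _⊔_; _≤_)
open import Data.Fin using (Fin; splitAt; _≟_)
open import Data.Fin.Base using () renaming (zero to fz; suc to fs)
open import Data.Sum using ([_,_]′)
open import Data.Product using (Σ; ∃; _×_)
open import Data.Bool using (Bool; true; false; _∧_; not)
open import Data.List using (List; map; filterᵇ; length; lookup; allFin)
open import Relation.Nullary using (¬_)
open import Relation.Nullary.Decidable using (⌊_⌋)
open import Relation.Binary.PropositionalEquality using (_≡_)
open import Function.Bundles using (_⇔_)

-- Short games: a game is given by finitely many Left options and
-- finitely many Right options (indexed by Fin m and Fin n).

data Game : Set where
  mk : (m n : ℕ) → (Fin m → Game) → (Fin n → Game) → Game

fromLists : List Game → List Game → Game
fromLists Ls Rs = mk (length Ls) (length Rs) (lookup Ls) (lookup Rs)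

infixl 6 _⊕_
_⊕_ : Game → Game → Game
X@(mk m n L R) ⊕ Y@(mk m' n' L' R') =
  mk (m + m') (n + n')
     (λ i → [ (λ j → L j ⊕ Y) , (λ j → X ⊕ L' j) ]′ (splitAt m i))
     (λ i → [ (λ j → R j ⊕ Y) , (λ j → X ⊕ R' j) ]′ (splitAt n i))

-- Normal-play outcomes (a player unable to move loses).

mutual
  LeftWinsFirst : Game → Set
  LeftWinsFirst (mk m n L R) = ∃ λ (i : Fin m) → LeftWinsSecond (L i)

  LeftWinsSecond : Game → Set
  LeftWinsSecond (mk m n L R) = (j : Fin n) → LeftWinsFirst (R j)

mutual
  RightWinsFirst : Game → Set
  RightWinsFirst (mk m n L R) = ∃ λ (j : Fin n) → RightWinsSecond (R j)

  RightWinsSecond : Game → Set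
  RightWinsSecond (mk m n L R) = (i : Fin m) → RightWinsFirst (L i)

-- The outcome class of G is determined by (who wins moving first as Left,
-- who wins moving first as Right); two games have the same outcome iff
-- these agree.
SameOutcome : Game → Game → Set
SameOutcome G H = (LeftWinsFirst G ⇔ LeftWinsFirst H) × (RightWinsFirst G ⇔ RightWinsFirst H)

infix 4 _≈_
_≈_ : Game → Game → Set
Y ≈ Z = (X : Game) → SameOutcome (X ⊕ Y) (X ⊕ Z)

maxF : (k : ℕ) → (Fin k → ℕ) → ℕ
maxF zero f = 0
maxF (suc k) f = f fz ⊔ maxF k (λ i → f (fs i))

birthday : Game → ℕ
birthday (mk m n L R) =
  maxF m (λ i → suc (birthday (L i))) ⊔ maxF n (λ j → suc (birthday (R j)))

BornBy : ℕ → Game → Set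
BornBy b X = ∃ λ G → birthday G ≤ b × G ≈ X

gIs : ℕ → ℕ → Set
gIs b k = Σ (Fin k → Game) λ v →
            ((i : Fin k) → BornBy b (v i))
          × ((i j : Fin k) → v i ≈ v j → i ≡ j)
          × ((X : Game) → BornBy b X → ∃ λ (i : Fin k) → X ≈ v i)

data Colour : Set where
  blue red : Colour

isBlue : Colour → Bool
isBlue blue = true
isBlue red  = false

isRed : Colour → Bool
isRed c = not (isBlue c)

-- A vertex-coloured digraph on vertex set Fin n; arc u v = true iff
-- there is an arc u → v (loops are irrelevant to the game).
record Digraph (n : ℕ) : Set where
  field
    colour : Fin n → Colour
    arc    : Fin n → Fin n → Bool
open Digraph public

delete : {n : ℕ} → Digraph n → (Fin n → Bool) → Fin n → (Fin n → Bool)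
delete D S v u = S u ∧ not ⌊ u ≟ v ⌋ ∧ not (arc D v u)

-- The game played on D with remaining vertex set S.  Every move deletes
-- at least one vertex, so fuel = number of vertices suffices.
dpPos : {n : ℕ} → Digraph n → ℕ → (Fin n → Bool) → Game
dpPos D zero    S = mk 0 0 (λ ()) (λ ())
dpPos {n} D (suc k) S =
  fromLists
    (map (λ v → dpPos D k (delete D S v))
         (filterᵇ (λ v → S v ∧ isBlue (colour D v)) (allFin n)))
    (map (λ v → dpPos D k (delete D S v))
         (filterᵇ (λ v → S v ∧ isRed (colour D v)) (allFin n)))

dpGame : {n : ℕ} → Digraph n → Game
dpGame {n} D = dpPos D n (λ _ → true)

{-# OPTIONS --safe #-}
module Submission where

-- The vertices are arranged in layers 0, …, b - 1.  For every value Q born by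
-- day j, layer j has a blue and a red vertex that moves to Q: its deletion
-- leaves the layers below j, where on layer j - 1 only those vertices survive
-- that lead to a legitimate option of Q.  Moves that skip a layer, and hence
-- do not correspond to options, are punished by guards.  On layer j these are
-- two groups of j + 2 vertices for each player.  A guard deletes everything
-- but its own group and one of the opponent's groups, chosen as in matching
-- pennies so that the opponent can answer with a guard that deletes the first
-- group and keeps j + 1 free moves; so playing a guard first is bad as well.  A
-- layer-skipping move spares the opponent's guards of the skipped layers.
--
-- This uses at most Σ_{j<b} (2 g(j) + 4 (j + 2)) vertices, with no guards on
-- layer 0.  The games { X | -b } and { b | X }, for X born by day b, are
-- new on day b + 1 and coincide only in { b | -b }, so that
-- g(b + 1) ≥ 3 g(b) - 1, which beats the number of vertices once g(2) = 22.

open import Defs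
open import Data.Bool using (Bool; true; false; _∧_; not; T)
open import Data.Bool.Properties using (T-∧; T-≡; T?)
import Data.Bool as Bool
open import Data.Empty using (⊥)
open import Data.Fin using (Fin; zero; suc; toℕ; splitAt; _↑ˡ_; _↑ʳ_; _≟_)
open import Data.Fin.Properties
  using (splitAt-↑ˡ; splitAt-↑ʳ; injective⇒≤; toℕ<n; toℕ-injective; suc-injective)
open import Data.Fin.Subset using (∣_∣)
open import Data.Fin.Subset.Properties using (p⊂q⇒∣p∣<∣q∣; ∣p∣≤n)
open import Data.List
  using (List; []; _∷_; _++_; map; filter; length; lookup; allFin; upTo; deduplicate;
         cartesianProduct; cartesianProductWith)
open import Data.List.Properties
  using (length-map; length-++; length-filter; length-upTo; filter-all)
open import Data.List.Membership.Propositional using (_∈_; lose; find)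
open import Data.List.Membership.Propositional.Properties
import Data.List.Relation.Unary.All as All
import Data.List.Relation.Unary.All.Properties as Allₚ
open All using (All; []; _∷_)
open import Data.List.Relation.Unary.AllPairs using (AllPairs; []; _∷_)
import Data.List.Relation.Unary.AllPairs.Properties as AllPairsₚ
open import Data.List.Relation.Unary.Any using (here; there; index)
import Data.List.Relation.Unary.Any.Properties as Anyₚ
open import Data.List.Relation.Unary.Unique.DecSetoid.Properties using (deduplicate-!)
open import Data.Nat hiding (_≟_)
import Data.Nat as ℕ
open import Data.Nat.Properties hiding (_≟_; suc-injective)
open import Data.Nat.Tactic.RingSolver using (solve-∀)
open import Data.Product using (Σ; ∃; ∃₂; _×_; _,_; proj₁; proj₂)
open import Data.Sum using (_⊎_; inj₁; inj₂; swap; [_,_]′)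
open import Data.Unit using (tt)
import Data.Vec as Vec
open Vec using (tabulate)
open import Data.Vec.Properties using (lookup∘tabulate; lookup⇒[]=; []=⇒lookup)
open import Function using (_∘_; id)
open import Function.Bundles using (mk⇔; Equivalence)
open import Relation.Binary.Bundles using (DecSetoid)
open import Relation.Binary.PropositionalEquality hiding ([_])
open import Relation.Nullary
open import Relation.Nullary.Decidable using (_×-dec_; _⊎-dec_)
open import Relation.Unary using (Decidable)

-- The order of games

opp : Colour → Colour
opp blue = red
opp red  = blue

♯ : Colour → Game → ℕ
♯ blue (mk m n L R) = m
♯ red  (mk m n L R) = n

option : (c : Colour) (G : Game) → Fin (♯ c G) → Game
option blue (mk m n L R) = L
option red  (mk m n L R) = R

infix 4 _≤[_]_ _⊲[_]_

mutual
  -- G ≤[ c ] H: the player c likes H at least as much as G.  Thus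
  -- ≤[ blue ] is the usual order of games and ≤[ red ] its converse;
  -- G ⊲[ c ] H is the negation of H ≤[ c ] G.
  data _≤[_]_ (G : Game) (c : Colour) (H : Game) : Set where
    le : (∀ i → option c G i ⊲[ c ] H) →
         (∀ j → G ⊲[ c ] option (opp c) H j) → G ≤[ c ] H

  data _⊲[_]_ (G : Game) (c : Colour) (H : Game) : Set where
    moveʳ : ∀ i → G ≤[ c ] option c H i → G ⊲[ c ] H
    moveˡ : ∀ j → option (opp c) G j ≤[ c ] H → G ⊲[ c ] H

mutual
  ≤-flip : ∀ {c G H} → G ≤[ c ] H → H ≤[ opp c ] G
  ≤-flip {blue} (le p q) = le (⊲-flip ∘ q) (⊲-flip ∘ p)
  ≤-flip {red}  (le p q) = le (⊲-flip ∘ q) (⊲-flip ∘ p)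

  ⊲-flip : ∀ {c G H} → G ⊲[ c ] H → H ⊲[ opp c ] G
  ⊲-flip {blue} (moveʳ i p) = moveˡ i (≤-flip p)
  ⊲-flip {blue} (moveˡ j p) = moveʳ j (≤-flip p)
  ⊲-flip {red}  (moveʳ i p) = moveˡ i (≤-flip p)
  ⊲-flip {red}  (moveˡ j p) = moveʳ j (≤-flip p)

≤[]-refl : ∀ {c} G → G ≤[ c ] G
≤[]-refl {blue} (mk m n L R) =
  le (λ i → moveʳ i (≤[]-refl (L i))) (λ j → moveˡ j (≤[]-refl (R j)))
≤[]-refl {red} (mk m n L R) =
  le (λ i → moveʳ i (≤[]-refl (R i))) (λ j → moveˡ j (≤[]-refl (L j)))

mutual
  ≤[]-trans : ∀ {c G H K} → G ≤[ c ] H → H ≤[ c ] K → G ≤[ c ] K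
  ≤[]-trans G≤H@(le p _) H≤K@(le _ q) =
    le (λ i → ⊲-≤-trans (p i) H≤K) (λ j → ≤-⊲-trans G≤H (q j))

  ⊲-≤-trans : ∀ {c G H K} → G ⊲[ c ] H → H ≤[ c ] K → G ⊲[ c ] K
  ⊲-≤-trans (moveʳ i G≤H′) (le p _) = ≤-⊲-trans G≤H′ (p i)
  ⊲-≤-trans (moveˡ j G′≤H) H≤K      = moveˡ j (≤[]-trans G′≤H H≤K)

  ≤-⊲-trans : ∀ {c G H K} → G ≤[ c ] H → H ⊲[ c ] K → G ⊲[ c ] K
  ≤-⊲-trans G≤H      (moveʳ i H≤K′) = moveʳ i (≤[]-trans G≤H H≤K′)
  ≤-⊲-trans (le _ q) (moveˡ j H′≤K) = ⊲-≤-trans (q j) H′≤K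

≤⇒¬⊲ : ∀ {c G H} → G ≤[ c ] H → ¬ H ⊲[ c ] G
≤⇒¬⊲ (le p _) (moveʳ i H≤G′) = ≤⇒¬⊲ H≤G′ (p i)
≤⇒¬⊲ (le _ q) (moveˡ j H′≤G) = ≤⇒¬⊲ H′≤G (q j)

option-⊲ : ∀ c G i → option c G i ⊲[ c ] G
option-⊲ c G i = moveʳ i (≤[]-refl _)

all-or-some : ∀ {n} {P Q : Fin n → Set} →
              (∀ i → P i ⊎ Q i) → (∀ i → P i) ⊎ ∃ Q
all-or-some {zero}  _ = inj₁ λ ()
all-or-some {suc n} f with f zero | all-or-some (f ∘ suc)
... | inj₂ q | _            = inj₂ (zero , q)
... | inj₁ _ | inj₂ (i , q) = inj₂ (suc i , q)
... | inj₁ p | inj₁ ps      = inj₁ λ { zero → p ; (suc i) → ps i }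

≤-or-⊲-blue : ∀ G H → G ≤[ blue ] H ⊎ H ⊲[ blue ] G
≤-or-⊲-blue G@(mk m n L R) H@(mk m′ n′ L′ R′)
  with all-or-some (λ i → swap (≤-or-⊲-blue H (L i)))
     | all-or-some (λ j → swap (≤-or-⊲-blue (R′ j) G))
... | inj₂ (i , H≤L) | _              = inj₂ (moveʳ i H≤L)
... | inj₁ _         | inj₂ (j , R≤G) = inj₂ (moveˡ j R≤G)
... | inj₁ p         | inj₁ q         = inj₁ (le p q)

≤-or-⊲ : ∀ c G H → G ≤[ c ] H ⊎ H ⊲[ c ] G
≤-or-⊲ blue G H = ≤-or-⊲-blue G H
≤-or-⊲ red  G H with ≤-or-⊲-blue H G
... | inj₁ p = inj₁ (≤-flip p)
... | inj₂ p = inj₂ (⊲-flip p)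

_≤[_]?_ : ∀ G c H → Dec (G ≤[ c ] H)
G ≤[ c ]? H with ≤-or-⊲ c G H
... | inj₁ p = yes p
... | inj₂ p = no λ G≤H → ≤⇒¬⊲ G≤H p

_⊲[_]?_ : ∀ G c H → Dec (G ⊲[ c ] H)
G ⊲[ c ]? H with ≤-or-⊲ c H G
... | inj₁ p = no (≤⇒¬⊲ p)
... | inj₂ p = yes p

infix 4 _≃_
-- Quantifying over the colour packs both inequalities into one statement, because `G ≤[ red ] H` is
-- `H ≤[ blue ] G`; proofs can then argue for one player `c` at a time.
_≃_ : Game → Game → Set
G ≃ H = ∀ c → G ≤[ c ] H

≃-intro : ∀ {G H} → G ≤[ blue ] H → H ≤[ blue ] G → G ≃ H
≃-intro p q blue = p
≃-intro p q red  = ≤-flip q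

_≃?_ : ∀ G H → Dec (G ≃ H)
G ≃? H with G ≤[ blue ]? H | H ≤[ blue ]? G
... | yes p | yes q = yes (≃-intro p q)
... | no ¬p | _     = no λ e → ¬p (e blue)
... | yes _ | no ¬q = no λ e → ¬q (≤-flip (e red))

≃-sym : ∀ {G H} → G ≃ H → H ≃ G
≃-sym e blue = ≤-flip (e red)
≃-sym e red  = ≤-flip (e blue)

≃-trans : ∀ {G H K} → G ≃ H → H ≃ K → G ≃ K
≃-trans e f c = ≤[]-trans (e c) (f c)

≃-decSetoid : DecSetoid _ _
≃-decSetoid = record
  { _≈_ = _≃_
  ; isDecEquivalence = record
      { isEquivalence = record
          { refl = λ {G} c → ≤[]-refl G ; sym = ≃-sym ; trans = ≃-trans }
      ; _≟_ = _≃?_ } }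

-- Enumeration of the values born by each day

sublists : ∀ {A : Set} → List A → List (List A)
sublists []       = [] ∷ []
sublists (x ∷ xs) = sublists xs ++ map (x ∷_) (sublists xs)

𝔾 : ℕ → List Game
𝔾 zero    = fromLists [] [] ∷ []
𝔾 (suc b) = deduplicate _≃?_
  (cartesianProductWith fromLists (sublists (𝔾 b)) (sublists (𝔾 b)))

-- Equality as equivalence in all contexts

-- Termination measure: for a variable `G`, `option c G i` is not a syntactic subterm, so
-- colour-uniform recursion on games descends along this predicate.
data Wf (G : Game) : Set where
  wf : (∀ c i → Wf (option c G i)) → Wf G

wf-game : ∀ G → Wf G
wf-game (mk m n L R) = wf λ { blue i → wf-game (L i) ; red j → wf-game (R j) }

WinsFirst WinsSecond : Colour → Game → Set
WinsFirst blue = LeftWinsFirst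
WinsFirst red  = RightWinsFirst
WinsSecond blue = LeftWinsSecond
WinsSecond red  = RightWinsSecond

first⁺ : ∀ c G i → WinsSecond c (option c G i) → WinsFirst c G
first⁺ blue (mk _ _ _ _) = _,_
first⁺ red  (mk _ _ _ _) = _,_

first⁻ : ∀ c G → WinsFirst c G → ∃ λ i → WinsSecond c (option c G i)
first⁻ blue (mk _ _ _ _) = id
first⁻ red  (mk _ _ _ _) = id

second⁺ : ∀ c G → (∀ j → WinsFirst c (option (opp c) G j)) → WinsSecond c G
second⁺ blue (mk _ _ _ _) = id
second⁺ red  (mk _ _ _ _) = id

second⁻ : ∀ c G → WinsSecond c G → ∀ j → WinsFirst c (option (opp c) G j)
second⁻ blue (mk _ _ _ _) = id
second⁻ red  (mk _ _ _ _) = id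

first-second-exclusive : ∀ c {G} → Wf G → WinsFirst c G → ¬ WinsSecond (opp c) G
first-second-exclusive blue {G} (wf w) x y with first⁻ blue G x
... | i , z = first-second-exclusive red (w blue i) (second⁻ red G y i) z
first-second-exclusive red {G} (wf w) x y with first⁻ red G x
... | i , z = first-second-exclusive blue (w red i) (second⁻ blue G y i) z

⊕-optionˡ : ∀ c X Y i → ∃ λ k → option c (X ⊕ Y) k ≡ option c X i ⊕ Y
⊕-optionˡ blue (mk m n L R) (mk m′ n′ L′ R′) i =
  i ↑ˡ m′ , cong [ _ , _ ]′ (splitAt-↑ˡ m i m′)
⊕-optionˡ red (mk m n L R) (mk m′ n′ L′ R′) i =
  i ↑ˡ n′ , cong [ _ , _ ]′ (splitAt-↑ˡ n i n′)

⊕-optionʳ : ∀ c X Y i → ∃ λ k → option c (X ⊕ Y) k ≡ X ⊕ option c Y i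
⊕-optionʳ blue (mk m n L R) (mk m′ n′ L′ R′) i =
  m ↑ʳ i , cong [ _ , _ ]′ (splitAt-↑ʳ m m′ i)
⊕-optionʳ red (mk m n L R) (mk m′ n′ L′ R′) i =
  n ↑ʳ i , cong [ _ , _ ]′ (splitAt-↑ʳ n n′ i)

⊕-option⁻ : ∀ c X Y k → (∃ λ i → option c (X ⊕ Y) k ≡ option c X i ⊕ Y) ⊎
                         (∃ λ i → option c (X ⊕ Y) k ≡ X ⊕ option c Y i)
⊕-option⁻ blue (mk m n L R) (mk m′ n′ L′ R′) k with splitAt m k
... | inj₁ i = inj₁ (i , refl)
... | inj₂ i = inj₂ (i , refl)
⊕-option⁻ red (mk m n L R) (mk m′ n′ L′ R′) k with splitAt n k
... | inj₁ i = inj₁ (i , refl)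
... | inj₂ i = inj₂ (i , refl)

first-⊕ˡ : ∀ c X Y i → WinsSecond c (option c X i ⊕ Y) → WinsFirst c (X ⊕ Y)
first-⊕ˡ c X Y i w with ⊕-optionˡ c X Y i
... | k , eq = first⁺ c (X ⊕ Y) k (subst (WinsSecond c) (sym eq) w)

first-⊕ʳ : ∀ c X Y i → WinsSecond c (X ⊕ option c Y i) → WinsFirst c (X ⊕ Y)
first-⊕ʳ c X Y i w with ⊕-optionʳ c X Y i
... | k , eq = first⁺ c (X ⊕ Y) k (subst (WinsSecond c) (sym eq) w)

first-⊕⁻ : ∀ c X Y → WinsFirst c (X ⊕ Y) →
           (∃ λ i → WinsSecond c (option c X i ⊕ Y)) ⊎
           (∃ λ i → WinsSecond c (X ⊕ option c Y i))
first-⊕⁻ c X Y w with first⁻ c (X ⊕ Y) w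
... | k , w′ with ⊕-option⁻ c X Y k
... | inj₁ (i , eq) = inj₁ (i , subst (WinsSecond c) eq w′)
... | inj₂ (i , eq) = inj₂ (i , subst (WinsSecond c) eq w′)

second-⊕ : ∀ c X Y →
           (∀ j → WinsFirst c (option (opp c) X j ⊕ Y)) →
           (∀ j → WinsFirst c (X ⊕ option (opp c) Y j)) →
           WinsSecond c (X ⊕ Y)
second-⊕ c X Y f g = second⁺ c (X ⊕ Y) λ k → h k (⊕-option⁻ (opp c) X Y k)
  where
  h : ∀ k → _ → WinsFirst c (option (opp c) (X ⊕ Y) k)
  h k (inj₁ (i , eq)) = subst (WinsFirst c) (sym eq) (f i)
  h k (inj₂ (i , eq)) = subst (WinsFirst c) (sym eq) (g i)

second-⊕⁻ˡ : ∀ c X Y → WinsSecond c (X ⊕ Y) →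
             ∀ j → WinsFirst c (option (opp c) X j ⊕ Y)
second-⊕⁻ˡ c X Y w j with ⊕-optionˡ (opp c) X Y j
... | k , eq = subst (WinsFirst c) eq (second⁻ c (X ⊕ Y) w k)

second-⊕⁻ʳ : ∀ c X Y → WinsSecond c (X ⊕ Y) →
             ∀ j → WinsFirst c (X ⊕ option (opp c) Y j)
second-⊕⁻ʳ c X Y w j with ⊕-optionʳ (opp c) X Y j
... | k , eq = subst (WinsFirst c) eq (second⁻ c (X ⊕ Y) w k)

-- The player `c` plays `X ⊕ H` by imitating `X ⊕ G`: moves in `X` are copied, and wherever the two
-- sums differ the derivation of `G ≤[ c ] H` supplies the next move.
mutual
  second-mono : ∀ c {X} → Wf X → ∀ {G H} → G ≤[ c ] H →
                WinsSecond c (X ⊕ G) → WinsSecond c (X ⊕ H)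
  second-mono c {X} (wf x) {G} {H} G≤H@(le _ q) w = second-⊕ c X H
    (λ j → first-mono c (x (opp c) j) G≤H (second-⊕⁻ˡ c X G w j))
    (λ j → second-first c (wf x) (q j) w)

  first-mono : ∀ c {X} → Wf X → ∀ {G H} → G ≤[ c ] H →
               WinsFirst c (X ⊕ G) → WinsFirst c (X ⊕ H)
  first-mono c {X} (wf x) {G} {H} G≤H@(le p _) w =
    [ (λ (i , w′) → first-⊕ˡ c X H i (second-mono c (x c i) G≤H w′))
    , (λ (i , w′) → second-first c (wf x) (p i) w′)
    ]′ (first-⊕⁻ c X G w)

  second-first : ∀ c {X} → Wf X → ∀ {G H} → G ⊲[ c ] H →
                 WinsSecond c (X ⊕ G) → WinsFirst c (X ⊕ H)
  second-first c {X} x {G} {H} (moveʳ i G≤H′) w =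
    first-⊕ʳ c X H i (second-mono c x G≤H′ w)
  second-first c {X} x {G} {H} (moveˡ j G′≤H) w =
    first-mono c x G′≤H (second-⊕⁻ʳ c X G w j)

≃⇒≈ : ∀ {G H} → G ≃ H → G ≈ H
≃⇒≈ e X = mk⇔ (mono blue e) (mono blue (≃-sym e)) ,
          mk⇔ (mono red e) (mono red (≃-sym e))
  where
  mono : ∀ c {G H} → G ≃ H → WinsFirst c (X ⊕ G) → WinsFirst c (X ⊕ H)
  mono c e = first-mono c (wf-game X) (e c)

neg : Game → Game
neg (mk m n L R) = mk n m (neg ∘ R) (neg ∘ L)

neg-option⁺ : ∀ c G i → ∃ λ k → option c (neg G) k ≡ neg (option (opp c) G i)
neg-option⁺ blue (mk _ _ _ _) i = i , refl
neg-option⁺ red  (mk _ _ _ _) i = i , refl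

neg-option⁻ : ∀ c G k → ∃ λ i → option (opp c) (neg G) k ≡ neg (option c G i)
neg-option⁻ blue (mk _ _ _ _) i = i , refl
neg-option⁻ red  (mk _ _ _ _) i = i , refl

-- A derivation of `G ≤[ c ] H` is itself a winning strategy for `c` in `H - G`: `le` covers the
-- opponent's moves in either summand, and `moveʳ` or `moveˡ` names the reply.
mutual
  ≤⇒second : ∀ c {G H} → G ≤[ c ] H → WinsSecond c (neg G ⊕ H)
  ≤⇒second c {G} {H} (le p q) = second-⊕ c (neg G) H
    (λ k → let i , eq = neg-option⁻ c G k in
           subst (λ Z → WinsFirst c (Z ⊕ H)) (sym eq) (⊲⇒first c (p i)))
    (λ j → ⊲⇒first c (q j))

  ⊲⇒first : ∀ c {G H} → G ⊲[ c ] H → WinsFirst c (neg G ⊕ H)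
  ⊲⇒first c {G} {H} (moveʳ i G≤H′) = first-⊕ʳ c (neg G) H i (≤⇒second c G≤H′)
  ⊲⇒first c {G} {H} (moveˡ j G′≤H) = let k , eq = neg-option⁺ c G j in
    first-⊕ˡ c (neg G) H k
      (subst (λ Z → WinsSecond c (Z ⊕ H)) (sym eq) (≤⇒second c G′≤H))

≈-first : ∀ c {G H} → G ≈ H → ∀ X → WinsFirst c (X ⊕ H) → WinsFirst c (X ⊕ G)
≈-first blue e X = Equivalence.from (proj₁ (e X))
≈-first red  e X = Equivalence.from (proj₂ (e X))

-- The context `neg G` separates the games: `c` wins `neg G ⊕ G` moving second, whereas `H ⊲[ c ] G`
-- would let the opponent win `neg G ⊕ H` moving first.
≈⇒≃ : ∀ {G H} → G ≈ H → G ≃ H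
≈⇒≃ {G} {H} e blue with ≤-or-⊲ blue G H
... | inj₁ G≤H = G≤H
... | inj₂ H⊲G = contradiction (≤⇒second blue (≤[]-refl G))
  (first-second-exclusive red (wf-game _)
    (≈-first red e (neg G) (⊲⇒first red (⊲-flip H⊲G))))
≈⇒≃ {G} {H} e red with ≤-or-⊲ red G H
... | inj₁ G≤H = G≤H
... | inj₂ H⊲G = contradiction (≤⇒second red (≤[]-refl G))
  (first-second-exclusive blue (wf-game _)
    (≈-first blue e (neg G) (⊲⇒first blue (⊲-flip H⊲G))))

-- Birthdays

maxF-upper : ∀ k f i → f i ≤ maxF k f
maxF-upper (suc k) f zero    = m≤m⊔n (f zero) _
maxF-upper (suc k) f (suc i) =
  ≤-trans (maxF-upper k (f ∘ suc) i) (m≤n⊔m (f zero) _)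

maxF-least : ∀ k f {b} → (∀ i → f i ≤ b) → maxF k f ≤ b
maxF-least zero    f h = z≤n
maxF-least (suc k) f h = ⊔-lub (h zero) (maxF-least k (f ∘ suc) (h ∘ suc))

birthday-option : ∀ c G i → birthday (option c G i) < birthday G
birthday-option blue (mk m n L R) i =
  ≤-trans (maxF-upper m (suc ∘ birthday ∘ L) i) (m≤m⊔n _ _)
birthday-option red (mk m n L R) i =
  ≤-trans (maxF-upper n (suc ∘ birthday ∘ R) i) (m≤n⊔m (maxF m _) _)

birthday-least : ∀ {b} G → (∀ c i → birthday (option c G i) < b) → birthday G ≤ b
birthday-least (mk m n L R) h =
  ⊔-lub (maxF-least m _ (h blue)) (maxF-least n _ (h red))

∈⇒lookup : ∀ {A : Set} {x : A} {xs} → x ∈ xs → ∃ λ i → lookup xs i ≡ x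
∈⇒lookup x∈xs = index x∈xs , sym (Anyₚ.lookup-index x∈xs)

sublist⁻ : ∀ {A : Set} {x : A} xs {ys} → ys ∈ sublists xs → x ∈ ys → x ∈ xs
sublist⁻ [] (here refl) ()
sublist⁻ (x ∷ xs) ys∈ x∈ys with ∈-++⁻ (sublists xs) ys∈
... | inj₁ p = there (sublist⁻ xs p x∈ys)
... | inj₂ p with ∈-map⁻ (x ∷_) p | x∈ys
... | _ , _ , refl | here eq = here eq
... | _ , q , refl | there r = there (sublist⁻ xs q r)

filter∈sublists : ∀ {A : Set} {P : A → Set} (P? : Decidable P) xs →
                  filter P? xs ∈ sublists xs
filter∈sublists P? [] = here refl
filter∈sublists P? (x ∷ xs) with does (P? x)
... | false = ∈-++⁺ˡ (filter∈sublists P? xs)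
... | true  = ∈-++⁺ʳ (sublists xs) (∈-map⁺ (x ∷_) (filter∈sublists P? xs))

𝔾-born : ∀ b {G} → G ∈ 𝔾 b → birthday G ≤ b
𝔾-born zero (here refl) = z≤n
𝔾-born (suc b) {G} G∈
  with ∈-cartesianProductWith⁻ fromLists (sublists (𝔾 b)) (sublists (𝔾 b))
         (∈-deduplicate⁻ _≃?_ _ G∈)
... | Ls , Rs , Ls∈ , Rs∈ , refl = birthday-least (fromLists Ls Rs) λ
  { blue i → s≤s (𝔾-born b (sublist⁻ (𝔾 b) Ls∈ (∈-lookup {xs = Ls} i)))
  ; red  i → s≤s (𝔾-born b (sublist⁻ (𝔾 b) Rs∈ (∈-lookup {xs = Rs} i))) }

-- Every game born by day b + 1 equals the one having as options all
-- games Q born by day b with Q ⊲ G, respectively G ⊲ Q.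
𝔾-complete : ∀ b G → birthday G ≤ b → ∃ λ H → H ∈ 𝔾 b × H ≃ G
𝔾-complete zero G G≤0 = fromLists [] [] , here refl ,
  ≃-intro (le (λ ()) λ j → contradiction (≤-trans (birthday-option red G j) G≤0) λ ())
          (le (λ j → contradiction (≤-trans (birthday-option blue G j) G≤0) λ ()) λ ())
𝔾-complete (suc b) G G≤1+b = find (Anyₚ.deduplicate⁺ _≃?_
    (λ e e′ → ≃-trans e e′)
    (lose (∈-cartesianProductWith⁺ fromLists (filter∈sublists _ (𝔾 b)) (filter∈sublists _ (𝔾 b))) H≃G))
  where
  Opts : Colour → List Game
  Opts c = filter (λ Q → Q ⊲[ c ]? G) (𝔾 b)

  H : Game
  H = fromLists (Opts blue) (Opts red)

  Opts⁺ : ∀ c j → ∃ λ Q → Q ∈ Opts c × Q ≃ option c G j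
  Opts⁺ c j with 𝔾-complete b (option c G j)
                   (≤-pred (≤-trans (birthday-option c G j) G≤1+b))
  ... | Q , Q∈ , e =
    Q , ∈-filter⁺ (λ Q → Q ⊲[ c ]? G) Q∈ (≤-⊲-trans (e c) (option-⊲ c G j)) , e

  Opts⁻ : ∀ c {Q} → Q ∈ Opts c → Q ⊲[ c ] G
  Opts⁻ c = proj₂ ∘ ∈-filter⁻ (λ Q → Q ⊲[ c ]? G) {xs = 𝔾 b}

  reply : ∀ c j → ∃ λ i → option c H i ≃ option c G j
  reply blue j with Opts⁺ blue j
  ... | Q , Q∈ , e with ∈⇒lookup Q∈
  ... | i , refl = i , e
  reply red j with Opts⁺ red j
  ... | Q , Q∈ , e with ∈⇒lookup Q∈
  ... | i , refl = i , e

  H≃G : H ≃ G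
  H≃G blue = le (λ i → Opts⁻ blue (∈-lookup i))
                  (λ j → let i , e = reply red j in moveˡ i (e blue))
  H≃G red  = le (λ i → Opts⁻ red (∈-lookup i))
                  (λ j → let i , e = reply blue j in moveˡ i (e red))

-- Lists of pairwise distinct values

Distinct : List Game → Set
Distinct = AllPairs λ G H → ¬ G ≃ H

𝔾-distinct : ∀ b → Distinct (𝔾 b)
𝔾-distinct zero    = [] ∷ []
𝔾-distinct (suc b) = deduplicate-! ≃-decSetoid _

distinct-lookup-injective : ∀ {xs} → Distinct xs →
                            ∀ i j → lookup xs i ≃ lookup xs j → i ≡ j
distinct-lookup-injective (_ ∷ _)  zero    zero    _ = refl
distinct-lookup-injective (x ∷ _)  zero    (suc j) e =
  contradiction e (All.lookup x (∈-lookup j))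
distinct-lookup-injective (x ∷ _)  (suc i) zero    e =
  contradiction (≃-sym e) (All.lookup x (∈-lookup i))
distinct-lookup-injective (_ ∷ xs) (suc i) (suc j) e =
  cong suc (distinct-lookup-injective xs i j e)

-- Pigeonhole: two members sent to the same index equal the same `v i`, hence each other.
distinct-length : ∀ {k xs} → Distinct xs → (v : Fin k → Game) →
                  (∀ {G} → G ∈ xs → ∃ λ i → G ≃ v i) → length xs ≤ k
distinct-length {xs = xs} d v f =
  injective⇒≤ {f = λ i → proj₁ (f (∈-lookup i))} λ {i} {j} eq →
    distinct-lookup-injective d i j
      (≃-trans (proj₂ (f (∈-lookup i)))
               (≃-sym (subst (λ k → lookup xs j ≃ v k) (sym eq) (proj₂ (f (∈-lookup j))))))

-- Growth of the number of values

integer : Colour → ℕ → Game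
integer c    zero    = fromLists [] []
integer blue (suc n) = fromLists (integer blue n ∷ []) []
integer red  (suc n) = fromLists [] (integer red n ∷ [])

birthday-integer : ∀ c n → birthday (integer c n) ≤ n
birthday-integer c    zero    = z≤n
birthday-integer blue (suc n) = birthday-least (integer blue (suc n)) λ
  { blue zero → s≤s (birthday-integer blue n) }
birthday-integer red  (suc n) = birthday-least (integer red (suc n)) λ
  { red zero → s≤s (birthday-integer red n) }

integer-no-option : ∀ c n → ¬ Fin (♯ (opp c) (integer c n))
integer-no-option blue zero    ()
integer-no-option red  zero    ()
integer-no-option blue (suc n) ()
integer-no-option red  (suc n) ()

-- Each move of `c` in `G` is matched by one of the `n` free moves, and the opponent has no move in
-- `integer c n`.
integer-greatest : ∀ c n G → birthday G ≤ n → G ≤[ c ] integer c n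
integer-greatest c zero G G≤n =
  le (λ i → contradiction (≤-trans (birthday-option c G i) G≤n) λ ())
     (λ j → contradiction j (integer-no-option c 0))
integer-greatest blue (suc n) G G≤n =
  le (λ i → moveʳ zero (integer-greatest blue n _ (≤-pred (≤-trans (birthday-option blue G i) G≤n))))
     λ ()
integer-greatest red (suc n) G G≤n =
  le (λ i → moveʳ zero (integer-greatest red n _ (≤-pred (≤-trans (birthday-option red G i) G≤n))))
     λ ()

integer-least : ∀ b {G} → birthday G ≤ b → integer red b ≤[ blue ] G
integer-least b G≤b = ≤-flip (integer-greatest red b _ G≤b)

allPairs-mapWith : ∀ {A : Set} {P : A → Set} {R S : A → A → Set} →
                   (∀ {x y} → P x → P y → R x y → S x y) →
                   ∀ {xs} → All P xs → AllPairs R xs → AllPairs S xs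
allPairs-mapWith f []       []       = []
allPairs-mapWith f (p ∷ ps) (r ∷ rs) =
  All.zipWith (λ (q , s) → f p q s) (ps , r) ∷ allPairs-mapWith f ps rs

distinct-filter-≄ : ∀ Z {xs} → Distinct xs →
                    length xs ≤ suc (length (filter (λ Y → ¬? (Y ≃? Z)) xs))
distinct-filter-≄ Z [] = z≤n
distinct-filter-≄ Z {x ∷ xs} (d ∷ ds) with x ≃? Z
... | no  _   = s≤s (distinct-filter-≄ Z ds)
-- The list is distinct, so once `x` equals `Z` nothing after it is removed.
... | yes x≃Z = s≤s (≤-reflexive (sym (cong length (filter-all _
  (All.map (λ x≄y y≃Z → x≄y (≃-trans x≃Z (≃-sym y≃Z))) d)))))

module _ (b : ℕ) where

  -- The threats -b and b are so large that X is not reversible, whence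
  -- distinct X give distinct games.
  threatR threatL : Game → Game
  threatR X = fromLists (X ∷ []) (integer red b ∷ [])
  threatL X = fromLists (integer blue b ∷ []) (X ∷ [])

  threatR-cancel : ∀ {X Y} → birthday X ≤ b →
                   threatR X ≤[ blue ] threatR Y → X ≤[ blue ] Y
  threatR-cancel {X} X≤b (le p _) with p zero
  ... | moveʳ zero X≤Y = X≤Y
  -- Here a Right option of `X` would lie below `threatR Y`, so that option would be `⊲ -b`; but
  -- `-b` is least among the values born by day `b`.
  ... | moveˡ j (le _ q) = contradiction (q zero) (≤⇒¬⊲
    (integer-least b (<⇒≤ (≤-trans (birthday-option red X j) X≤b))))

  threatL-cancel : ∀ {X Y} → birthday Y ≤ b →
                   threatL X ≤[ blue ] threatL Y → X ≤[ blue ] Y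
  threatL-cancel {X} {Y} Y≤b (le _ q) with q zero
  ... | moveˡ zero X≤Y = X≤Y
  ... | moveʳ i (le p _) = contradiction (p zero) (≤⇒¬⊲
    (integer-greatest blue b _ (<⇒≤ (≤-trans (birthday-option blue Y i) Y≤b))))

  threatR-new : ∀ {X Z} → birthday Z ≤ b → ¬ Z ≤[ blue ] threatR X
  threatR-new Z≤b (le _ q) = ≤⇒¬⊲ (integer-least b Z≤b) (q zero)

  threatL-new : ∀ {X Z} → birthday Z ≤ b → ¬ threatL X ≤[ blue ] Z
  threatL-new Z≤b (le p _) = ≤⇒¬⊲ (integer-greatest blue b _ Z≤b) (p zero)

  -- The Right option `-b` of `threatR X` would force `threatL Y ⊲ -b`. Left has no move in `-b`, so
  -- only Right's move to `Y` is left, and it would need `Y ≤ -b`.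
  threatL≰threatR : ∀ {X Y} → ¬ Y ≤[ blue ] integer red b →
                    ¬ threatL Y ≤[ blue ] threatR X
  threatL≰threatR ¬Y≤-b (le _ q) with q zero
  ... | moveʳ i _       = integer-no-option red b i
  ... | moveˡ zero Y≤-b = ¬Y≤-b Y≤-b

  above : List Game
  above = filter (λ Y → ¬? (Y ≃? integer red b)) (𝔾 b)

  above⁻ : ∀ {Y} → Y ∈ above → birthday Y ≤ b × ¬ Y ≤[ blue ] integer red b
  above⁻ {Y} Y∈ with ∈-filter⁻ (λ Y → ¬? (Y ≃? integer red b)) {xs = 𝔾 b} Y∈
  ... | Y∈𝔾 , Y≄-b = Y≤b , λ Y≤-b → Y≄-b (≃-intro Y≤-b (integer-least b Y≤b))
    where Y≤b = 𝔾-born b Y∈𝔾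

  -- The filter removes the coincidence { b | -b } of the two families.
  family : List Game
  family = 𝔾 b ++ map threatR (𝔾 b) ++ map threatL above

  family-distinct : Distinct family
  family-distinct = AllPairsₚ.++⁺ (𝔾-distinct b)
    (AllPairsₚ.++⁺
      (AllPairsₚ.map⁺ {f = threatR} (allPairs-mapWith
        (λ X≤b Y≤b X≄Y e → X≄Y (≃-intro (threatR-cancel X≤b (e blue))
                                         (threatR-cancel Y≤b (≃-sym e blue))))
        born (𝔾-distinct b)))
      (AllPairsₚ.map⁺ {f = threatL} (allPairs-mapWith
        (λ X≤b Y≤b X≄Y e → X≄Y (≃-intro (threatL-cancel Y≤b (e blue))
                                         (threatL-cancel X≤b (≃-sym e blue))))
        (All.tabulate (proj₁ ∘ above⁻))
        (AllPairsₚ.filter⁺ _ (𝔾-distinct b))))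
      (Allₚ.map⁺ {xs = 𝔾 b} (All.tabulate λ _ → Allₚ.map⁺ {xs = above} (All.tabulate λ Y∈ e →
        threatL≰threatR (proj₂ (above⁻ Y∈)) (≃-sym e blue)))))
    (All.map (λ Z≤b → Allₚ.++⁺
        (Allₚ.map⁺ {xs = 𝔾 b} (All.tabulate λ _ e → threatR-new Z≤b (e blue)))
        (Allₚ.map⁺ {xs = above} (All.tabulate λ _ e → threatL-new Z≤b (≃-sym e blue))))
      born)
    where
    born : All (λ G → birthday G ≤ b) (𝔾 b)
    born = All.tabulate (𝔾-born b)

  family-born : ∀ {G} → G ∈ family → birthday G ≤ suc b
  family-born G∈ with ∈-++⁻ (𝔾 b) G∈
  ... | inj₁ G∈𝔾 = m≤n⇒m≤1+n (𝔾-born b G∈𝔾)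
  ... | inj₂ G∈′ with ∈-++⁻ (map threatR (𝔾 b)) G∈′
  ... | inj₁ p with ∈-map⁻ threatR p
  ... | X , X∈ , refl = birthday-least (threatR X) λ
    { blue zero → s≤s (𝔾-born b X∈) ; red zero → s≤s (birthday-integer red b) }
  family-born G∈ | inj₂ _ | inj₂ p with ∈-map⁻ threatL p
  ... | X , X∈ , refl = birthday-least (threatL X) λ
    { blue zero → s≤s (birthday-integer blue b) ; red zero → s≤s (proj₁ (above⁻ X∈)) }

∣𝔾∣ : ℕ → ℕ
∣𝔾∣ b = length (𝔾 b)

-- All members of `family b` are distinct and born by day b + 1; the `suc` pays for the value that
-- `above` omits.
∣𝔾∣-growth : ∀ b → 3 * ∣𝔾∣ b ≤ suc (∣𝔾∣ (suc b))
∣𝔾∣-growth b = begin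
  3 * ∣𝔾∣ b                                    ≡⟨ cong (λ n → g + (g + n)) (+-identityʳ g) ⟩
  g + (g + g)                                  ≤⟨ +-monoʳ-≤ g (+-monoʳ-≤ g (distinct-filter-≄ (integer red b) (𝔾-distinct b))) ⟩
  g + (g + suc (length (above b)))             ≡⟨ cong (g +_) (+-suc g _) ⟩
  g + suc (g + length (above b))               ≡⟨ +-suc g _ ⟩
  suc (g + (g + length (above b)))             ≡⟨ cong suc lengths ⟨
  suc (length (family b))                      ≤⟨ s≤s (distinct-length (family-distinct b) (lookup (𝔾 (suc b))) place) ⟩
  suc (∣𝔾∣ (suc b))                            ∎
  where
  open ≤-Reasoning
  g = ∣𝔾∣ b
  lengths : length (family b) ≡ g + (g + length (above b))
  lengths rewrite length-++ (𝔾 b) {map (threatR b) (𝔾 b) ++ map (threatL b) (above b)}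
                | length-++ (map (threatR b) (𝔾 b)) {map (threatL b) (above b)}
                | length-map (threatR b) (𝔾 b) | length-map (threatL b) (above b) = refl
  place : ∀ {G} → G ∈ family b → ∃ λ i → G ≃ lookup (𝔾 (suc b)) i
  place {G} G∈ with 𝔾-complete (suc b) G (family-born b G∈)
  ... | H , H∈ , e with ∈⇒lookup H∈
  ... | i , refl = i , ≃-sym e

-- Positions of a digraph placement game

opp≢ : ∀ {c} → opp c ≢ c
opp≢ {blue} ()
opp≢ {red}  ()

¬c⇒opp : ∀ {c d} → d ≢ c → d ≡ opp c
¬c⇒opp {blue} {blue} d≢c = contradiction refl d≢c
¬c⇒opp {blue} {red}  _   = refl
¬c⇒opp {red}  {blue} _   = refl
¬c⇒opp {red}  {red}  d≢c = contradiction refl d≢c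

_≟ᶜ_ : (c d : Colour) → Dec (c ≡ d)
blue ≟ᶜ blue = yes refl
blue ≟ᶜ red  = no λ ()
red  ≟ᶜ blue = no λ ()
red  ≟ᶜ red  = yes refl

module _ {n : ℕ} (D : Digraph n) where

  delete⁺ : ∀ {S v u} → T (S u) → u ≢ v → ¬ T (arc D v u) → T (delete D S v u)
  delete⁺ {S} {v} {u} Su u≢v ¬a with S u | u ≟ v | arc D v u
  ... | true | yes u≡v | _     = contradiction u≡v u≢v
  ... | true | no _    | true  = contradiction tt ¬a
  ... | true | no _    | false = tt

  delete⁻ : ∀ {S v u} → T (delete D S v u) → T (S u) × u ≢ v × ¬ T (arc D v u)
  delete⁻ {S} {v} {u} d with S u | u ≟ v | arc D v u
  ... | true | no u≢v | false = tt , u≢v , λ ()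

  size : (Fin n → Bool) → ℕ
  size S = ∣ tabulate S ∣

  size-delete : ∀ {S v} → T (S v) → size (delete D S v) < size S
  size-delete {S} {v} Sv = p⊂q⇒∣p∣<∣q∣
    ( (λ u∈ → T⇒∈ S (proj₁ (delete⁻ {S} (∈⇒T (delete D S v) u∈))))
    , v , T⇒∈ S Sv , λ v∈ → proj₁ (proj₂ (delete⁻ {S} (∈⇒T (delete D S v) v∈))) refl )
    where
    T⇒∈ : ∀ S {u} → T (S u) → tabulate S Vec.[ u ]= true
    T⇒∈ S {u} Su = lookup⇒[]= u _ (trans (lookup∘tabulate S u) (Equivalence.to T-≡ Su))
    ∈⇒T : ∀ S {u} → tabulate S Vec.[ u ]= true → T (S u)
    ∈⇒T S {u} u∈ = Equivalence.from T-≡ (trans (sym (lookup∘tabulate S u)) ([]=⇒lookup u∈))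

  private
    is : Colour → Colour → Bool
    is blue = isBlue
    is red  = isRed

    is⁺ : ∀ c {d} → d ≡ c → T (is c d)
    is⁺ blue refl = tt
    is⁺ red  refl = tt

    is⁻ : ∀ c {d} → T (is c d) → d ≡ c
    is⁻ blue {blue} _ = refl
    is⁻ red  {red}  _ = refl

    movers : Colour → (Fin n → Bool) → List (Fin n)
    movers c S = filter (λ v → T? (S v ∧ is c (colour D v))) (allFin n)

    movers⁺ : ∀ c {S v} → T (S v) → colour D v ≡ c → v ∈ movers c S
    movers⁺ c Sv eq = ∈-filter⁺ _ (∈-allFin _) (Equivalence.from T-∧ (Sv , is⁺ c eq))

    movers⁻ : ∀ c {S v} → v ∈ movers c S → T (S v) × colour D v ≡ c
    movers⁻ c {S} v∈ with ∈-filter⁻ (λ v → T? (S v ∧ is c (colour D v))) {xs = allFin n} v∈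
    ... | _ , t with Equivalence.to T-∧ t
    ... | Sv , eq = Sv , is⁻ c eq

    options : ∀ c k S → (i : Fin (♯ c (dpPos D (suc k) S))) →
              option c (dpPos D (suc k) S) i ∈ map (λ v → dpPos D k (delete D S v)) (movers c S)
    options blue k S i = ∈-lookup i
    options red  k S i = ∈-lookup i

    options⁻ : ∀ c k S {G} → G ∈ map (λ v → dpPos D k (delete D S v)) (movers c S) →
               ∃ λ i → option c (dpPos D (suc k) S) i ≡ G
    options⁻ blue k S = ∈⇒lookup
    options⁻ red  k S = ∈⇒lookup

  -- Any fuel `k` with `size S ≤ k` will do. The bound is inherited by the option because a move
  -- deletes at least its own vertex; the new fuel is existential because `k` is a successor only
  -- once a move exists.
  dp-option⁺ : ∀ c k {S v} → size S ≤ k → T (S v) → colour D v ≡ c →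
               ∃₂ λ k′ i → size (delete D S v) ≤ k′ ×
                 option c (dpPos D k S) i ≡ dpPos D k′ (delete D S v)
  dp-option⁺ c zero S≤k Sv eq = contradiction (≤-trans (size-delete Sv) S≤k) λ ()
  dp-option⁺ c (suc k) {S} S≤k Sv eq
    with options⁻ c k S (∈-map⁺ (λ v → dpPos D k (delete D S v)) (movers⁺ c Sv eq))
  ... | i , eq′ = k , i , ≤-pred (≤-trans (size-delete Sv) S≤k) , eq′

  dp-option⁻ : ∀ c k {S} i → size S ≤ k →
               ∃₂ λ k′ v → T (S v) × colour D v ≡ c × size (delete D S v) ≤ k′ ×
                 option c (dpPos D k S) i ≡ dpPos D k′ (delete D S v)
  dp-option⁻ blue zero ()
  dp-option⁻ red  zero ()
  dp-option⁻ c (suc k) {S} i S≤k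
    with ∈-map⁻ (λ v → dpPos D k (delete D S v)) (options c k S i)
  ... | v , v∈ , eq with movers⁻ c v∈
  ... | Sv , cv = k , v , Sv , cv , ≤-pred (≤-trans (size-delete Sv) S≤k) , eq

  -- Only `opp c` can move in this position, and the vertices `f i` do not delete one another, so
  -- they are `m` moves in hand. Each move of `opp c` in `X` is matched by one of them, and the
  -- birthday of `X` allows at most `m`.
  free-moves : ∀ c m k {S} X → birthday X ≤ m → size S ≤ k →
               (∀ {u} → T (S u) → colour D u ≡ opp c) →
               (f : Fin m → Fin n) → (∀ {i j} → f i ≡ f j → i ≡ j) →
               (∀ i → T (S (f i))) → (∀ i j → ¬ T (arc D (f i) (f j))) →
               dpPos D k S ≤[ c ] X
  free-moves c m k {S} X X≤m S≤k mono f inj Sf indep = le noMove (answer m X≤m f inj Sf indep)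
    where
    noMove : ∀ i → option c (dpPos D k S) i ⊲[ c ] X
    noMove i with dp-option⁻ c k i S≤k
    ... | _ , _ , Sv , cv , _ = contradiction (trans (sym (mono Sv)) cv) opp≢

    answer : ∀ m → birthday X ≤ m → (f : Fin m → Fin n) → (∀ {i j} → f i ≡ f j → i ≡ j) →
             (∀ i → T (S (f i))) → (∀ i j → ¬ T (arc D (f i) (f j))) →
             ∀ j → dpPos D k S ⊲[ c ] option (opp c) X j
    answer zero    X≤0 _ _ _ _ j =
      contradiction (≤-trans (birthday-option (opp c) X j) X≤0) λ ()
    answer (suc m) X≤m f inj Sf indep j
      with dp-option⁺ (opp c) k {S} {f zero} S≤k (Sf zero) (mono (Sf zero))
    ... | k′ , i , S′≤k′ , eq = moveˡ i (subst (_≤[ c ] option (opp c) X j) (sym eq)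
      (free-moves c m k′ _ (≤-pred (≤-trans (birthday-option (opp c) X j) X≤m)) S′≤k′
        (λ d → mono (proj₁ (delete⁻ {S} d))) (f ∘ suc) (suc-injective ∘ inj)
        (λ i → delete⁺ {S} (Sf (suc i)) (λ e → contradiction (inj e) λ ()) (indep zero (suc i)))
        (λ i j → indep (suc i) (suc j))))

-- The layered digraph

-- goto j c Q lies on layer j, belongs to c and moves to Q; guard j c t s is
-- the s-th member of group t of the guards of c on layer j.
data Vertex : Set where
  goto  : ℕ → Colour → Game → Vertex
  guard : ℕ → Colour → Bool → ℕ → Vertex

owner : Vertex → Colour
owner (goto _ c _)    = c
owner (guard _ c _ _) = c

-- The vertices remaining in the position P born by day l.
Live : ℕ → Game → Vertex → Set
Live l P (goto j c Q)    = suc j < l ⊎ (suc j ≡ l × Q ⊲[ c ] P)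
Live l P (guard j _ _ _) = j < l

-- The group of opp c spared by group t of c.
partner : Colour → Bool → Bool
partner blue t = not t
partner red  t = t

-- Matching pennies: one colour copies the group and the other switches it. Hence a reply from the
-- group that a guard spared spares the other group of that guard's owner and deletes the first
-- guard's group.
partner-partner : ∀ c t → partner (opp c) (partner c t) ≢ t
partner-partner blue true  ()
partner-partner blue false ()
partner-partner red  true  ()
partner-partner red  false ()

-- The complement of the arc relation. The clause `j < j′` for a `goto` matters only when layers are
-- skipped: in a legal move no guard above layer `j` remains.
Survives : Vertex → Vertex → Set
Survives (goto j c Q) v@(goto _ _ _)    = Live j Q v
Survives (goto j c Q) (guard j′ c′ _ _) = j′ < j ⊎ (j < j′ × c′ ≡ opp c)
Survives (guard j c t s) (goto _ _ _)   = ⊥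
Survives (guard j c t s) (guard j′ c′ t′ _) =
  (c′ ≡ c × t′ ≡ t) ⊎ (j ≤ j′ × c′ ≡ opp c × t′ ≡ partner c t)

live? : ∀ l P v → Dec (Live l P v)
live? l P (goto j c Q)    = suc j <? l ⊎-dec (suc j ℕ.≟ l ×-dec (Q ⊲[ c ]? P))
live? l P (guard j _ _ _) = j <? l

survives? : ∀ v w → Dec (Survives v w)
survives? (goto j c Q) v@(goto _ _ _)    = live? j Q v
survives? (goto j c Q) (guard j′ c′ _ _) = j′ <? j ⊎-dec (j <? j′ ×-dec c′ ≟ᶜ opp c)
survives? (guard j c t s) (goto _ _ _)   = no λ ()
survives? (guard j c t s) (guard j′ c′ t′ _) =
  (c′ ≟ᶜ c ×-dec t′ Bool.≟ t) ⊎-dec (j ≤? j′ ×-dec c′ ≟ᶜ opp c ×-dec t′ Bool.≟ partner c t)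

-- Layer j ≥ 1 gets j + 2 per group: one to answer with and j + 1 free moves against a game born by
-- day j + 1. Below layer 0 there is nothing to jump to, so it needs no guards.
guards : ℕ → ℕ
guards zero    = 0
guards (suc j) = 3 + j

Valid : Vertex → Set
Valid (goto j c Q)    = Q ∈ 𝔾 j
Valid (guard j c t s) = s < guards j

placement : (vs : List Vertex) → Digraph (length vs)
placement vs = record
  { colour = owner ∘ lookup vs
  ; arc    = λ u v → not (does (survives? (lookup vs u) (lookup vs v))) }

-- Correctness of the layered digraph

module Play (vs : List Vertex) (valid : ∀ {v} → v ∈ vs → Valid v) where

  D : Digraph (length vs)
  D = placement vs

  at : Fin (length vs) → Vertex
  at = lookup vs

  State : Set
  State = Fin (length vs) → Bool

  Alive : State → Vertex → Set
  Alive S v = ∃ λ u → at u ≡ v × T (S u)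

  no-arc : ∀ {u v} → Survives (at u) (at v) → ¬ T (arc D u v)
  no-arc {u} {v} s a with survives? (at u) (at v)
  ... | no ¬s = ¬s s

  no-arc⁻ : ∀ {u v} → ¬ T (arc D u v) → Survives (at u) (at v)
  no-arc⁻ {u} {v} ¬a with survives? (at u) (at v)
  ... | yes s = s
  ... | no _  = contradiction tt ¬a

  alive-delete : ∀ {S u w} → Alive S w → w ≢ at u → Survives (at u) w →
                 Alive (delete D S u) w
  alive-delete {S} (v , refl , Sv) w≢ s =
    v , refl , delete⁺ D {S} Sv (λ { refl → w≢ refl }) (no-arc s)

  delete-survives : ∀ {S u v} → T (delete D S u v) → T (S v) × Survives (at u) (at v)
  delete-survives {S} d with delete⁻ D {S} d
  ... | Sv , _ , ¬a = Sv , no-arc⁻ ¬a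

  record Position (l : ℕ) (P : Game) (S : State) : Set where
    field
      sound    : ∀ {u} → T (S u) → Live l P (at u)
      complete : ∀ {v} → Valid v → Live l P v → Alive S v
  open Position

  -- The answer is the guard of number 0; the remaining suc i guards of its
  -- kind are free moves, more than X can offset.
  punish : ∀ c i t {S} k X → birthday X ≤ suc i → size D S ≤ k →
           (∀ s → s < 2 + i → Alive S (guard i (opp c) t s)) →
           (∀ {u} → T (S u) → owner (at u) ≡ c → ¬ Survives (guard i (opp c) t 0) (at u)) →
           dpPos D k S ⊲[ c ] X
  punish c i t {S} k X X≤ S≤k alive doomed with alive 0 z<s
  ... | u₀ , eq₀ , Su₀ with dp-option⁺ D (opp c) k S≤k Su₀ (cong owner eq₀)
  ... | k′ , o , S′≤k′ , eq = moveˡ o (subst (_≤[ c ] X) (sym eq)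
    (free-moves D c (suc i) k′ X X≤ S′≤k′ mono (proj₁ ∘ rest) inj
      (λ x → proj₂ (proj₂ (rest x)))
      (λ x y → no-arc (subst₂ Survives (sym (at-rest x)) (sym (at-rest y)) (inj₁ (refl , refl))))))
    where
    rest : (x : Fin (suc i)) → Alive (delete D S u₀) (guard i (opp c) t (suc (toℕ x)))
    rest x = alive-delete {S} {u₀} (alive (suc (toℕ x)) (s≤s (toℕ<n x)))
      (λ e → contradiction (trans e eq₀) λ ())
      (subst (λ w → Survives w _) (sym eq₀) (inj₁ (refl , refl)))

    at-rest : ∀ x → at (proj₁ (rest x)) ≡ guard i (opp c) t (suc (toℕ x))
    at-rest x = proj₁ (proj₂ (rest x))

    inj : ∀ {x y} → proj₁ (rest x) ≡ proj₁ (rest y) → x ≡ y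
    inj {x} {y} e with trans (sym (at-rest x)) (trans (cong at e) (at-rest y))
    ... | e′ = toℕ-injective (guard-injective e′)
      where
      guard-injective : ∀ {s s′} → guard i (opp c) t (suc s) ≡ guard i (opp c) t (suc s′) → s ≡ s′
      guard-injective refl = refl

    mono : ∀ {u} → T (delete D S u₀ u) → owner (at u) ≡ opp c
    mono d = ¬c⇒opp λ cu → let Su , s = delete-survives {S} d in
      doomed Su cu (subst (λ w → Survives w _) eq₀ s)

  legal-position : ∀ {j c Q P S u} → at u ≡ goto j c Q → Position (suc j) P S →
                   Position j Q (delete D S u)
  legal-position {j} {c} {Q} {P} {S} {u} at-u pos = record
    { sound = λ {v} d → let Sv , s = delete-survives {S} d in
        sound′ (at v) (sound pos Sv) (subst (λ w → Survives w (at v)) at-u s)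
    ; complete = λ {v} val live →
        alive-delete (complete pos val (weaken v live))
          (λ e → irreflexive (subst (Live j Q) (trans e at-u) live))
          (subst (λ w → Survives w v) (sym at-u) (survives v live)) }
    where
    sound′ : ∀ v → Live (suc j) P v → Survives (goto j c Q) v → Live j Q v
    sound′ (goto _ _ _)    _          s              = s
    sound′ (guard _ _ _ _) _          (inj₁ j′<j)    = j′<j
    -- At level `suc j` no guard lies above layer `j`, so a legal move exposes none.
    sound′ (guard _ _ _ _) (s≤s j′≤j) (inj₂ (j<j′ , _)) = contradiction j<j′ (≤⇒≯ j′≤j)

    weaken : ∀ v → Live j Q v → Live (suc j) P v
    weaken (goto _ _ _)    (inj₁ j′<j)       = inj₁ (m≤n⇒m≤1+n j′<j)
    weaken (goto _ _ _)    (inj₂ (refl , _)) = inj₁ ≤-refl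
    weaken (guard _ _ _ _) j′<j              = m≤n⇒m≤1+n j′<j

    survives : ∀ v → Live j Q v → Survives (goto j c Q) v
    survives (goto _ _ _)    live = live
    survives (guard _ _ _ _) j′<j = inj₁ j′<j

    irreflexive : ¬ Live j Q (goto j c Q)
    irreflexive (inj₁ j+1<j)     = <-irrefl refl (<-trans (n<1+n j) j+1<j)
    irreflexive (inj₂ (eq , _)) = 1+n≢n eq

  -- A jump past the top layer spares both groups of `opp c` there; group `true` is an arbitrary
  -- choice for the reply. The guards of `c` that survive the jump lie below layer `j`, and the
  -- reply deletes them together with every `goto`.
  illegal-goto : ∀ {i j c Q P S u} k → birthday P ≤ suc i → Position (suc i) P S →
                 at u ≡ goto j c Q → j < i → size D (delete D S u) ≤ k →
                 dpPos D k (delete D S u) ⊲[ c ] P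
  illegal-goto {zero} _ _ _ _ ()
  illegal-goto {suc i} {j} {c} {Q} {P} {S} {u} k P≤ pos at-u j<i S′≤k =
    punish c (suc i) true k P P≤ S′≤k
      (λ s s<3+i → alive-delete {S} {u} (complete pos s<3+i ≤-refl)
        (λ e → contradiction (trans e at-u) λ ())
        (subst (λ w → Survives w _) (sym at-u) (inj₂ (j<i , refl))))
      (λ {v} d cv → doomed (at v) cv
        (subst (λ w → Survives w (at v)) at-u (proj₂ (delete-survives {S} d))))
    where
    doomed : ∀ v → owner v ≡ c → Survives (goto j c Q) v →
             ¬ Survives (guard (suc i) (opp c) true 0) v
    doomed (guard _ _ _ _) refl _                (inj₁ (c≡ , _))   = opp≢ (sym c≡)
    doomed (guard _ _ _ _) refl (inj₁ j′<j)      (inj₂ (i≤j′ , _)) =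
      <-asym (<-≤-trans j<i i≤j′) j′<j
    doomed (guard _ _ _ _) refl (inj₂ (_ , c≡)) _                  = opp≢ (sym c≡)

  -- The reply comes from the spared group on the top layer. After the first guard `c` owns only
  -- group `t`, which the reply deletes by `partner-partner`.
  guard-move : ∀ {i j c t s P S u} k → birthday P ≤ suc i → Position (suc i) P S →
               at u ≡ guard j c t s → j ≤ i → s < guards j → size D (delete D S u) ≤ k →
               dpPos D k (delete D S u) ⊲[ c ] P
  guard-move {zero} _ _ _ _ z≤n ()
  guard-move {suc i} {j} {c} {t} {s} {P} {S} {u} k P≤ pos at-u j≤i _ S′≤k =
    punish c (suc i) (partner c t) k P P≤ S′≤k
      (λ s′ s′<3+i → alive-delete {S} {u} (complete pos s′<3+i ≤-refl)
        (λ e → opp≢ (cong owner (trans e at-u)))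
        (subst (λ w → Survives w _) (sym at-u) (inj₂ (j≤i , refl , refl))))
      (λ {v} d cv → doomed (at v) cv
        (subst (λ w → Survives w (at v)) at-u (proj₂ (delete-survives {S} d))))
    where
    doomed : ∀ v → owner v ≡ c → Survives (guard j c t s) v →
             ¬ Survives (guard (suc i) (opp c) (partner c t) 0) v
    doomed (guard _ _ _ _) refl (inj₂ (_ , c≡ , _)) _                = opp≢ (sym c≡)
    doomed (guard _ _ _ _) refl (inj₁ _)            (inj₁ (c≡ , _)) = opp≢ (sym c≡)
    doomed (guard _ _ _ _) refl (inj₁ (_ , t≡))     (inj₂ (_ , _ , t≡′)) =
      partner-partner c t (trans (sym t≡′) t≡)

  Correct : ℕ → Set
  Correct l = ∀ P k {S} → birthday P ≤ l → Position l P S → size D S ≤ k →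
              dpPos D k S ≃ P

  -- A `goto` on the top layer reaches, by induction, some `Q` with `Q ⊲[ c ] P`; every other move
  -- is punished. The induction hypothesis is phrased through `suc i ≡ l` to include level 0.
  moves : ∀ l → (∀ {i} → suc i ≡ l → Correct i) →
          ∀ {P S} k c → birthday P ≤ l → Position l P S → size D S ≤ k →
          ∀ i → option c (dpPos D k S) i ⊲[ c ] P
  moves l correct {P} {S} k c P≤l pos S≤k i with dp-option⁻ D c k i S≤k
  ... | k′ , u , Su , cu , S′≤k′ , eq =
    subst (_⊲[ c ] P) (sym eq) (move (at u) refl cu (sound pos Su) (valid (∈-lookup u)))
    where
    move : ∀ v → at u ≡ v → owner v ≡ c → Live l P v → Valid v →
           dpPos D k′ (delete D S u) ⊲[ c ] P
    move (goto j c Q) at-u refl (inj₂ (refl , Q⊲P)) Q∈ =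
      ≤-⊲-trans (correct refl Q k′ (𝔾-born j Q∈) (legal-position at-u pos) S′≤k′ c) Q⊲P
    move (goto j c Q) at-u refl (inj₁ (s≤s j<i)) _ =
      illegal-goto k′ P≤l pos at-u j<i S′≤k′
    move (guard j c t s) at-u refl (s≤s j≤i) s< =
      guard-move k′ P≤l pos at-u j≤i s< S′≤k′

  -- An option of `P` equals some `Q` in `𝔾 i`; being an option makes `goto i (opp c) Q` live, and
  -- that vertex is the answer.
  answers : ∀ l → (∀ {i} → suc i ≡ l → Correct i) →
            ∀ {P S} k c → birthday P ≤ l → Position l P S → size D S ≤ k →
            ∀ j → dpPos D k S ⊲[ c ] option (opp c) P j
  answers zero _ {P} k c P≤0 _ _ j =
    contradiction (≤-trans (birthday-option (opp c) P j) P≤0) λ ()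
  answers (suc i) correct {P} {S} k c P≤ pos S≤k j
    with 𝔾-complete i (option (opp c) P j) (≤-pred (≤-trans (birthday-option (opp c) P j) P≤))
  ... | Q , Q∈ , e
    with complete pos {goto i (opp c) Q} Q∈
           (inj₂ (refl , ≤-⊲-trans (e (opp c)) (option-⊲ (opp c) P j)))
  ... | u , at-u , Su with dp-option⁺ D (opp c) k S≤k Su (cong owner at-u)
  ... | k′ , o , S′≤k′ , eq = moveˡ o (subst (_≤[ c ] option (opp c) P j) (sym eq)
    (≤[]-trans (correct refl Q k′ (𝔾-born i Q∈) (legal-position at-u pos) S′≤k′ c) (e c)))

  correct : ∀ l → Correct l
  correct zero    P k P≤ pos S≤k c =
    le (moves 0 (λ ()) k c P≤ pos S≤k) (answers 0 (λ ()) k c P≤ pos S≤k)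
  correct (suc l) P k P≤ pos S≤k c =
    le (moves (suc l) ih k c P≤ pos S≤k) (answers (suc l) ih k c P≤ pos S≤k)
    where
    ih : ∀ {i} → suc i ≡ suc l → Correct i
    ih refl = correct l

-- Counting vertices

colours : List Colour
colours = blue ∷ red ∷ []

kinds : List (Colour × Bool)
kinds = cartesianProduct colours (true ∷ false ∷ [])

gotos guardians layer : ℕ → List Vertex
gotos j     = cartesianProductWith (goto j) colours (𝔾 j)
guardians j = cartesianProductWith (λ (c , t) → guard j c t) kinds (upTo (guards j))
layer j     = gotos j ++ guardians j

layers : ℕ → List Vertex
layers zero    = []
layers (suc b) = layers b ++ layer b

-- Doubled, to compare with g(b + 1) without fractions.
cost : ℕ → ℕ
cost b = 2 * (length (layers b) + b)

length-cartesianProductWith : ∀ {A B C : Set} (f : A → B → C) xs ys →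
  length (cartesianProductWith f xs ys) ≡ length xs * length ys
length-cartesianProductWith f []       ys = refl
length-cartesianProductWith f (x ∷ xs) ys = trans (length-++ (map (f x) ys))
  (cong₂ _+_ (length-map (f x) ys) (length-cartesianProductWith f xs ys))

length-layer : ∀ j → length (layer j) ≡ 2 * ∣𝔾∣ j + 4 * guards j
length-layer j = trans (length-++ (gotos j))
  (cong₂ _+_ (length-cartesianProductWith (goto j) colours (𝔾 j))
    (trans (length-cartesianProductWith (λ (c , t) → guard j c t) kinds (upTo (guards j)))
           (cong (4 *_) (length-upTo (guards j)))))

cost-suc : ∀ b → cost (suc b) ≡ cost b + (4 * ∣𝔾∣ b + (8 * guards b + 2))
cost-suc b rewrite length-++ (layers b) {layer b} | length-layer b =
  lemma (length (layers b)) b (∣𝔾∣ b) (guards b)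
  where
  lemma : ∀ n b g h → 2 * (n + (2 * g + 4 * h) + suc b) ≡ 2 * (n + b) + (4 * g + (8 * h + 2))
  lemma = solve-∀

∈-colours : ∀ c → c ∈ colours
∈-colours blue = here refl
∈-colours red  = there (here refl)

∈-kinds : ∀ c t → (c , t) ∈ kinds
∈-kinds c true  = ∈-cartesianProduct⁺ {xs = colours} {ys = true ∷ false ∷ []} (∈-colours c) (here refl)
∈-kinds c false = ∈-cartesianProduct⁺ {xs = colours} {ys = true ∷ false ∷ []} (∈-colours c) (there (here refl))

layer-valid : ∀ j {v} → v ∈ layer j → Valid v
layer-valid j v∈ with ∈-++⁻ (gotos j) v∈
... | inj₁ p with ∈-cartesianProductWith⁻ (goto j) colours (𝔾 j) p
... | _ , _ , _ , Q∈ , refl = Q∈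
layer-valid j v∈ | inj₂ p
  with ∈-cartesianProductWith⁻ (λ (c , t) → guard j c t) kinds (upTo (guards j)) p
... | _ , _ , _ , s∈ , refl = ∈-upTo⁻ s∈

layers-valid : ∀ b {v} → v ∈ layers b → Valid v
layers-valid (suc b) v∈ with ∈-++⁻ (layers b) v∈
... | inj₁ p = layers-valid b p
... | inj₂ p = layer-valid b p

layers-⊇ : ∀ {j b v} → j < b → v ∈ layer j → v ∈ layers b
layers-⊇ {j} {suc b} (s≤s j≤b) v∈ with m≤n⇒m<n∨m≡n j≤b
... | inj₁ j<b  = ∈-++⁺ˡ (layers-⊇ j<b v∈)
... | inj₂ refl = ∈-++⁺ʳ (layers b) v∈

layers-complete : ∀ {b P v} → Valid v → Live b P v → v ∈ layers b
layers-complete {b} {P} {goto j c Q} Q∈ live = layers-⊇ (lt live)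
  (∈-++⁺ˡ (∈-cartesianProductWith⁺ (goto j) (∈-colours c) Q∈))
  where
  lt : Live b P (goto j c Q) → j < b
  lt (inj₁ j+1<b)      = <⇒≤ j+1<b
  lt (inj₂ (refl , _)) = ≤-refl
layers-complete {v = guard j c t s} s< j<b = layers-⊇ j<b
  (∈-++⁺ʳ (gotos j)
    (∈-cartesianProductWith⁺ (λ (c , t) → guard j c t) (∈-kinds c t) (∈-upTo⁺ s<)))

-- `P` only selects among the `goto` vertices of the top layer; the rest of `layers b` is kept, so
-- one list bounds the count for all `P`.
realisable : ∀ b P → birthday P ≤ b →
             ∃₂ λ n (D : Digraph n) → dpGame D ≃ P × 2 * (n + b) ≤ cost b
realisable b P P≤b = length vs , placement vs ,
  correct b P (length vs) P≤b
    (record { sound = λ {u} _ → proj₂ (vs⁻ (∈-lookup u))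
            ; complete = λ val live → let i , eq = ∈⇒lookup (vs⁺ val live) in i , eq , tt })
    (∣p∣≤n (tabulate (λ (_ : Fin (length vs)) → true))) ,
  *-monoʳ-≤ 2 (+-monoˡ-≤ b (length-filter (live? b P) (layers b)))
  where
  vs : List Vertex
  vs = filter (live? b P) (layers b)
  vs⁻ : ∀ {v} → v ∈ vs → v ∈ layers b × Live b P v
  vs⁻ = ∈-filter⁻ (live? b P) {xs = layers b}
  vs⁺ : ∀ {v} → Valid v → Live b P v → v ∈ vs
  vs⁺ val live = ∈-filter⁺ (live? b P) (layers-complete val live) live
  open Play vs (layers-valid b ∘ proj₁ ∘ vs⁻)

-- The numerical comparison of vertices and values.

-- Stated for abstract sequences so that 𝔾 b is never evaluated for b > 2.
module _ (g cost : ℕ → ℕ)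
         (g₀ : g 0 ≡ 1) (g₁ : g 1 ≡ 4) (g₂ : g 2 ≡ 22)
         (growth : ∀ b → 3 * g b ≤ suc (g (suc b)))
         (cost-zero : cost 0 ≡ 0)
         (cost-suc : ∀ b → cost (suc b) ≡ cost b + (4 * g b + (8 * guards b + 2)))
         where

  -- Twice this bound, 8 b + 38, absorbs the guard term 8 (4 + b) + 2 in `cost-bound`.
  growth-linear : ∀ b → 4 * b + 19 ≤ g (2 + b)
  growth-linear zero rewrite g₂ = ≤ᵇ⇒≤ 19 22 tt
  growth-linear (suc b) = ≤-pred (begin
    suc (4 * suc b + 19)                 ≤⟨ m≤m+n _ (8 * b + 33) ⟩
    suc (4 * suc b + 19) + (8 * b + 33)  ≡⟨ lemma b ⟩
    3 * (4 * b + 19)                     ≤⟨ *-monoʳ-≤ 3 (growth-linear b) ⟩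
    3 * g (2 + b)                        ≤⟨ growth (2 + b) ⟩
    suc (g (3 + b))                      ∎)
    where
    open ≤-Reasoning
    lemma : ∀ b → suc (4 * suc b + 19) + (8 * b + 33) ≡ 3 * (4 * b + 19)
    lemma = solve-∀

  -- Induction: the increment of the cost is at most 6 g(b + 2), which growth bounds by 2 g(b + 3) +
  -- 2; with the hypothesis this makes about 3 g(b + 3), and growth applies again. The first two
  -- cases are numerical, 6 < 22 and 48 < 65, as the linear bound starts at g(2).
  cost-bound : ∀ b → cost (suc b) < g (2 + b)
  cost-bound zero rewrite cost-suc 0 | cost-zero | g₀ | g₂ = ≤ᵇ⇒≤ 7 22 tt
  cost-bound (suc zero) = ≤-trans cost₂ (≤-pred growth₂)
    where
    cost₂ : cost 2 < 65
    cost₂ rewrite cost-suc 1 | cost-suc 0 | cost-zero | g₀ | g₁ = ≤ᵇ⇒≤ 49 65 tt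
    growth₂ : 66 ≤ suc (g 3)
    growth₂ = subst (λ n → 3 * n ≤ suc (g 3)) g₂ (growth 2)
  -- The added 3 covers the `suc` in `growth`, which is used twice for `e` and once for `y`.
  cost-bound (suc (suc b)) = +-cancelˡ-≤ 3 _ _ (begin
    3 + suc (cost (3 + b))                  ≡⟨ cong (4 +_) (cost-suc (2 + b)) ⟩
    4 + (x + (4 * e + (8 * (4 + b) + 2)))   ≤⟨ n≤1+n _ ⟩
    5 + (x + (4 * e + (8 * (4 + b) + 2)))   ≡⟨ lemma₁ x e b ⟩
    suc x + (4 * e + 2 * (4 * b + 19))      ≤⟨ +-mono-≤ (cost-bound (suc b)) (+-monoʳ-≤ (4 * e) (*-monoʳ-≤ 2 (growth-linear b))) ⟩
    y + (4 * e + 2 * e)                     ≡⟨ lemma₂ y e ⟩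
    y + 2 * (3 * e)                         ≤⟨ +-monoʳ-≤ y (*-monoʳ-≤ 2 (growth (2 + b))) ⟩
    y + 2 * suc y                           ≡⟨ lemma₃ y ⟩
    2 + 3 * y                               ≤⟨ +-monoʳ-≤ 2 (growth (3 + b)) ⟩
    3 + z                                   ∎)
    where
    open ≤-Reasoning
    x = cost (2 + b)
    e = g (2 + b)
    y = g (3 + b)
    z = g (4 + b)
    lemma₁ : ∀ x e b → 5 + (x + (4 * e + (8 * (4 + b) + 2))) ≡ suc x + (4 * e + 2 * (4 * b + 19))
    lemma₁ = solve-∀
    lemma₂ : ∀ y e → y + (4 * e + 2 * e) ≡ y + 2 * (3 * e)
    lemma₂ = solve-∀
    lemma₃ : ∀ y → y + 2 * suc y ≡ 2 + 3 * y
    lemma₃ = solve-∀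

-- Transfer to an arbitrary enumeration of the values

bornBy : ∀ b {G} → birthday G ≤ b → BornBy b G
bornBy b {G} G≤b = G , G≤b , ≃⇒≈ (λ c → ≤[]-refl G)

∣𝔾∣≤gIs : ∀ b {k} → gIs b k → ∣𝔾∣ b ≤ k
∣𝔾∣≤gIs b (v , _ , _ , surjective) = distinct-length (𝔾-distinct b) v λ {G} G∈ →
  let i , G≈vᵢ = surjective G (bornBy b (𝔾-born b G∈)) in i , ≈⇒≃ G≈vᵢ

theorem14 : (b : ℕ) → 1 ≤ b → (k : ℕ) → gIs (suc b) k →
    (X : Game) → BornBy b X →
    Σ ℕ λ n → Σ (Digraph n) λ D → dpGame D ≈ X × 2 * (n + b) < k
theorem14 (suc b) _ k g X (G , G≤b , G≈X) with realisable (suc b) G G≤b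
... | n , D , D≃G , n≤ = n , D , ≃⇒≈ (≃-trans D≃G (≈⇒≃ G≈X)) ,
  -- The first three `refl` count the values 1, 4 and 22 of days 0 to 2 by evaluation.
  <-≤-trans (≤-<-trans n≤ (cost-bound ∣𝔾∣ cost refl refl refl ∣𝔾∣-growth refl cost-suc b)) (∣𝔾∣≤gIs (2 + b) g)
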